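{- Let $k\ge 1$ and let $G=K_{n_1,n_2,\dots,n_p}$ be a complete $p$-partite graph with $\delta(G)\ge k$ and $n_1\le n_2\le\dots\le n_p$. Suppose the set \[ M=\{x\in\mathbb{Z}_{>0} : \text{there is an integer } \ell \text{ with } 2\le \ell\le p,\ (\ell-1)x=k,\ x\le\min\{k,n_1,\dots,n_\ell\}\} \] is nonempty. Then $\gamma_{\times k,t}(G)\le k+\min M$.
   Context: A set $S\subseteq V(G)$ is a $k$-tuple total dominating set ($k$TDS) of a graph $G$ with $\delta(G)\ge k$ if $|N_G(x)\cap S|\ge k$ for every $x\in V(G)$. The $k$-tuple total domination number $\gamma_{\times k,t}(G)$ is the minimum cardinality of a $k$TDS of $G$. $K_{n_1,\dots,n_p}$ denotes the complete $p$-partite graph with parts of sizes $n_1,\dots,n_p$. -}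

module Defs where

open import Data.Fin.Base using (Fin; zero; suc; splitAt)
import Data.Fin.Base as Fin
open import Data.Fin.Properties using (all?) renaming (_≟_ to _≟ᶠ_)
open import Data.Fin.Subset using (Subset; _∩_; ∣_∣; ⊤)
open import Data.Fin.Subset.Properties using (anySubset?; ∩-identityʳ)
import Data.List.Base as List
open import Data.List.Membership.Propositional.Properties using (∈-allFin; ∈-map⁺)
import Data.List.Relation.Unary.All as All
open import Data.List.Extrema.Nat using (min; min≤xs)
open import Data.Nat.Base
open import Data.Nat.Properties
open import Data.Product.Base using (∃; ∃-syntax; _×_; _,_; proj₁; proj₂)
open import Data.Sum.Base using ([_,_]′)
open import Data.Vec.Base using (Vec; []; _∷_; lookup; sum; tabulate; toList)
open import Function.Base using (_∘_; const)
open import Level using (0ℓ)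
open import Relation.Binary.Core using (Rel)
import Relation.Binary.Definitions as B
open import Relation.Binary.PropositionalEquality
open import Relation.Nullary
open import Relation.Nullary.Decidable using (does; map′; _×-dec_; ¬?)
open import Relation.Unary using (Pred; Decidable)

IsMinimum : Pred ℕ 0ℓ → Pred ℕ 0ℓ
IsMinimum P m = P m × (∀ j → P j → m ≤ j)

findMinimum : {P : Pred ℕ 0ℓ} → Decidable P → ∀ n → P n → ∃ (IsMinimum P)
findMinimum P? zero    p = 0 , p , λ _ _ → z≤n
findMinimum P? (suc n) p with P? 0
... | yes p₀ = 0 , p₀ , λ _ _ → z≤n
... | no ¬p₀ with findMinimum (P? ∘ suc) n p
...   | m , pm , lb = suc m , pm , λ where
          zero    p₀ → contradiction p₀ ¬p₀
          (suc j) pj → s≤s (lb j pj)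

minimum : {P : Pred ℕ 0ℓ} → Decidable P → ∃ P → ℕ
minimum P? (n , p) = proj₁ (findMinimum P? n p)

minimum-isMinimum : {P : Pred ℕ 0ℓ} (P? : Decidable P) (ne : ∃ P) →
                    IsMinimum P (minimum P? ne)
minimum-isMinimum P? (n , p) = proj₂ (findMinimum P? n p)

record Graph (v : ℕ) : Set₁ where
  field
    Adj    : Rel (Fin v) 0ℓ
    adj?   : B.Decidable Adj
    symm   : B.Symmetric Adj
    irrefl : ∀ x → ¬ Adj x x

  N : Fin v → Subset v
  N x = tabulate (λ y → does (adj? x y))

  deg : Fin v → ℕ
  deg x = ∣ N x ∣

  -- `min v` caps the value at v. Every degree is at most v, so the cap
  -- only matters for the graph without vertices, where δ is then 0.
  δ : ℕ
  δ = min v (List.map deg (List.allFin v))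

  δ≤deg : ∀ x → δ ≤ deg x
  δ≤deg x = All.lookup (min≤xs v (List.map deg (List.allFin v)))
                       (∈-map⁺ deg (∈-allFin x))

open Graph public using (N; deg; δ)

module _ {v : ℕ} (k : ℕ) (G : Graph v) where

  IsTupleTotalDominating : Subset v → Set
  IsTupleTotalDominating S = ∀ x → k ≤ ∣ N G x ∩ S ∣

  HasTupleTotalDominatingSetOfSize : Pred ℕ 0ℓ
  HasTupleTotalDominatingSetOfSize s = ∃[ S ] IsTupleTotalDominating S × ∣ S ∣ ≡ s

  hasTupleTotalDominatingSetOfSize? : Decidable HasTupleTotalDominatingSetOfSize
  hasTupleTotalDominatingSetOfSize? s =
    anySubset? λ S → all? (λ x → k ≤? ∣ N G x ∩ S ∣) ×-dec (∣ S ∣ ≟ s)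

  module _ (k≤δ : k ≤ δ G) where

    ⊤-isTupleTotalDominating : IsTupleTotalDominating ⊤
    ⊤-isTupleTotalDominating x =
      subst (λ S → k ≤ ∣ S ∣) (sym (∩-identityʳ (N G x))) (≤-trans k≤δ (Graph.δ≤deg G x))

    γ×t : ℕ
    γ×t = minimum hasTupleTotalDominatingSetOfSize? (∣ ⊤ {v} ∣ , ⊤ , ⊤-isTupleTotalDominating , refl)

-- The vertices of the multipartite graph are numbered consecutively: the
-- first n₁ form part 1, the next n₂ part 2, and so on.
partOf : ∀ {p} (ns : Vec ℕ p) → Fin (sum ns) → Fin p
partOf (n ∷ ns) x = [ const zero , suc ∘ partOf ns ]′ (splitAt n x)

completeMultipartite : ∀ {p} (ns : Vec ℕ p) → Graph (sum ns)
completeMultipartite ns = record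
  { Adj    = λ x y → partOf ns x ≢ partOf ns y
  ; adj?   = λ x y → ¬? (partOf ns x ≟ᶠ partOf ns y)
  ; symm   = λ x≢y → x≢y ∘ sym
  ; irrefl = λ _ x≢x → x≢x refl
  }

NonDecreasing : ∀ {p} → Vec ℕ p → Set
NonDecreasing ns = ∀ {i j} → i Fin.≤ j → lookup ns i ≤ lookup ns j

module _ {p : ℕ} (k : ℕ) (ns : Vec ℕ p) where

  -- `min k (n₁ , … , n_ℓ)` is the minimum of {k, n₁, …, n_ℓ}.
  IsPartCount : ℕ → Pred ℕ 0ℓ
  IsPartCount x ℓ =
    2 ≤ ℓ × ℓ ≤ p × (ℓ ∸ 1) * x ≡ k × x ≤ min k (List.take ℓ (toList ns))

  M : Pred ℕ 0ℓ
  M x = 0 < x × ∃ (IsPartCount x)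

  M? : Decidable M
  M? x = (0 <? x) ×-dec map′
    (λ (ℓ , _ , q) → ℓ , q)
    (λ (ℓ , q@(_ , ℓ≤p , _)) → ℓ , s≤s ℓ≤p , q)
    (anyUpTo? (λ ℓ → (2 ≤? ℓ) ×-dec (ℓ ≤? p) ×-dec ((ℓ ∸ 1) * x ≟ k) ×-dec
                     (x ≤? min k (List.take ℓ (toList ns)))) (suc p))

{-# OPTIONS --safe #-}
module Submission where

-- Let m = min M, so k = (ℓ − 1)m for some ℓ, and let S consist of m vertices
-- from each of the first ℓ parts. Then |S| = ℓm = k + m, and since a vertex
-- misses only the elements of S in its own part, at most m of them, it has at
-- least ℓm − m = k neighbours in S.

open import Defs
open import Data.Bool.Base using (Bool; true; false; not; _∧_)
open import Data.Fin.Base using (Fin; zero; suc; _↑ˡ_; _↑ʳ_)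
open import Data.Fin.Properties using (splitAt-↑ˡ; splitAt-↑ʳ) renaming (_≟_ to _≟ᶠ_)
open import Data.Fin.Subset using (Subset; inside; outside; _∩_; ∣_∣; ⊤; ⊥)
open import Data.Fin.Subset.Properties using (∣⊥∣≡0)
import Data.List.Base as List
open import Data.List.Extrema.Nat using (min≤xs)
open import Data.List.Relation.Unary.All as All using (All; _∷_)
open import Data.Nat.Base using (ℕ; zero; suc; _+_; _*_; _≤_; z≤n; s≤s)
open import Data.Nat.Properties
open import Data.Product.Base using (∃; ∃-syntax; _×_; _,_)
open import Data.Vec.Base using (Vec; []; _∷_; _++_; sum; tabulate; padRight; toList)
open import Data.Vec.Properties using (tabulate-cong)
open import Function.Base using (_∘_; const)
open import Relation.Binary.PropositionalEquality
open import Relation.Nullary.Decidable using (does)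

∣inside∩p∣≡∣p∣ : ∀ {n} (p : Subset n) → ∣ tabulate (const inside) ∩ p ∣ ≡ ∣ p ∣
∣inside∩p∣≡∣p∣ []          = refl
∣inside∩p∣≡∣p∣ (true ∷ p)  = cong suc (∣inside∩p∣≡∣p∣ p)
∣inside∩p∣≡∣p∣ (false ∷ p) = ∣inside∩p∣≡∣p∣ p

∣p++q∣≡∣p∣+∣q∣ : ∀ {m n} (p : Subset m) (q : Subset n) → ∣ p ++ q ∣ ≡ ∣ p ∣ + ∣ q ∣
∣p++q∣≡∣p∣+∣q∣ []          q = refl
∣p++q∣≡∣p∣+∣q∣ (true ∷ p)  q = cong suc (∣p++q∣≡∣p∣+∣q∣ p q)
∣p++q∣≡∣p∣+∣q∣ (false ∷ p) q = ∣p++q∣≡∣p∣+∣q∣ p q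

-- Splits a count at a block boundary. With `f` arbitrary and only pointwise equal to `g` and `h` on
-- the blocks, the induction can shift to `f ∘ suc`, which `partOf` itself would not allow.
∣tabulate∩++∣ : ∀ {m n} (f : Fin (m + n) → Bool) {g : Fin m → Bool} {h : Fin n → Bool} →
                (∀ i → f (i ↑ˡ n) ≡ g i) → (∀ j → f (m ↑ʳ j) ≡ h j) →
                (p : Subset m) (q : Subset n) →
                ∣ tabulate f ∩ (p ++ q) ∣ ≡ ∣ tabulate g ∩ p ∣ + ∣ tabulate h ∩ q ∣
∣tabulate∩++∣ f f≗g f≗h [] q = cong (λ r → ∣ r ∩ q ∣) (tabulate-cong f≗h)
∣tabulate∩++∣ f {g} f≗g f≗h (b ∷ p) q rewrite f≗g zero with g zero ∧ b
... | true  = cong suc (∣tabulate∩++∣ (f ∘ suc) (f≗g ∘ suc) f≗h p q)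
... | false = ∣tabulate∩++∣ (f ∘ suc) (f≗g ∘ suc) f≗h p q

∣padRight-⊤∣ : ∀ {m n} (m≤n : m ≤ n) → ∣ padRight m≤n outside ⊤ ∣ ≡ m
∣padRight-⊤∣ {n = n} z≤n = ∣⊥∣≡0 n
∣padRight-⊤∣ (s≤s m≤n)   = cong suc (∣padRight-⊤∣ m≤n)

-- Indexed by a part instead of a vertex, to suit induction over the parts. At `i = partOf ns v` its
-- tabulation is definitionally the neighbourhood of `v`.
outsidePart : ∀ {p} (ns : Vec ℕ p) → Fin p → Fin (sum ns) → Bool
outsidePart ns i y = not (does (i ≟ᶠ partOf ns y))

partOf-↑ˡ : ∀ {p} n (ns : Vec ℕ p) y → partOf (n ∷ ns) (y ↑ˡ sum ns) ≡ zero
partOf-↑ˡ n ns y rewrite splitAt-↑ˡ n y (sum ns) = refl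

partOf-↑ʳ : ∀ {p} n (ns : Vec ℕ p) y → partOf (n ∷ ns) (n ↑ʳ y) ≡ suc (partOf ns y)
partOf-↑ʳ n ns y rewrite splitAt-↑ʳ n (sum ns) y = refl

∣outsidePart-∷∩++∣ : ∀ {p} n (ns : Vec ℕ p) i (q : Subset n) (r : Subset (sum ns)) →
  ∣ tabulate (outsidePart (n ∷ ns) i) ∩ (q ++ r) ∣ ≡
  ∣ tabulate {n = n} (λ _ → not (does (i ≟ᶠ zero))) ∩ q ∣ +
  ∣ tabulate (λ y → not (does (i ≟ᶠ suc (partOf ns y)))) ∩ r ∣
∣outsidePart-∷∩++∣ n ns i = ∣tabulate∩++∣ (outsidePart (n ∷ ns) i)
  (λ y → cong (λ j → not (does (i ≟ᶠ j))) (partOf-↑ˡ n ns y))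
  (λ y → cong (λ j → not (does (i ≟ᶠ j))) (partOf-↑ʳ n ns y))

-- The inequality is |S| − x ≤ |S outside part i|, free of truncated subtraction.
equalSelection : ∀ {p} (ns : Vec ℕ p) x ℓ → ℓ ≤ p → All (x ≤_) (List.take ℓ (toList ns)) →
  ∃[ S ] ∣ S ∣ ≡ ℓ * x × (∀ i → ℓ * x ≤ x + ∣ tabulate (outsidePart ns i) ∩ S ∣)
equalSelection ns       x zero    _         _            = ⊥ , ∣⊥∣≡0 (sum ns) , λ _ → z≤n
equalSelection (n ∷ ns) x (suc ℓ) (s≤s ℓ≤p) (x≤n ∷ x≤ns)
  with equalSelection ns x ℓ ℓ≤p x≤ns
... | S , ∣S∣≡ℓx , avoids = P ++ S , ∣P++S∣≡x+ℓx , avoids′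
  where
  P : Subset n
  P = padRight x≤n outside ⊤

  ∣P++S∣≡x+ℓx : ∣ P ++ S ∣ ≡ x + ℓ * x
  ∣P++S∣≡x+ℓx = trans (∣p++q∣≡∣p∣+∣q∣ P S) (cong₂ _+_ (∣padRight-⊤∣ x≤n) ∣S∣≡ℓx)

  avoids′ : ∀ i → x + ℓ * x ≤ x + ∣ tabulate (outsidePart (n ∷ ns) i) ∩ (P ++ S) ∣
  avoids′ i rewrite ∣outsidePart-∷∩++∣ n ns i P S with i
  -- Part `i` is the leading one: all of `S` lies outside it and already supplies `ℓ * x`.
  ... | zero  rewrite ∣inside∩p∣≡∣p∣ S | ∣S∣≡ℓx = +-monoʳ-≤ x (m≤n+m (ℓ * x) _)
  -- Part `i` comes later: all `x` elements of `P` lie outside it, and the induction hypothesis for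
  -- `j` bounds the rest.
  ... | suc j rewrite ∣inside∩p∣≡∣p∣ P | ∣padRight-⊤∣ x≤n = +-monoʳ-≤ x (avoids j)

γ×t≤∣S∣ : ∀ {v k} (G : Graph v) (k≤δ : k ≤ δ G) (S : Subset v) →
          IsTupleTotalDominating k G S → γ×t k G k≤δ ≤ ∣ S ∣
γ×t≤∣S∣ {v} {k} G k≤δ S dominating =
  let _ , least = minimum-isMinimum (hasTupleTotalDominatingSetOfSize? k G)
                    -- The same witness as in the definition of `γ×t`, so that this minimum is `γ×t`
                    -- itself.
                    (∣ ⊤ {v} ∣ , ⊤ , ⊤-isTupleTotalDominating k G k≤δ , refl)
  in least ∣ S ∣ (S , dominating , refl)

γ×t≤k+x : ∀ {p k} (ns : Vec ℕ p) (k≤δ : k ≤ δ (completeMultipartite ns)) {x} → M k ns x →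
          γ×t k (completeMultipartite ns) k≤δ ≤ k + x
-- The number of parts is `suc ℓ`, so matching `refl` turns `k` into `ℓ * x`, and `suc ℓ * x`
-- unfolds to `x + k`.
γ×t≤k+x {k = k} ns k≤δ {x} (_ , suc ℓ , _ , ℓ≤p , refl , x≤min) =
  let firstParts           = List.take (suc ℓ) (toList ns)
      x≤firstParts         = All.map (≤-trans x≤min) (min≤xs k firstParts)
      S , ∣S∣≡x+k , avoids = equalSelection ns x (suc ℓ) ℓ≤p x≤firstParts
      -- Here `avoids` reads `x + k ≤ x + ∣ N G v ∩ S ∣`; cancelling `x` gives domination at `v`.
      dominating           = λ v → +-cancelˡ-≤ x _ _ (avoids (partOf ns v))
      G                    = completeMultipartite ns
  in begin
    γ×t k G k≤δ  ≤⟨ γ×t≤∣S∣ G k≤δ S dominating ⟩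
    ∣ S ∣        ≡⟨ ∣S∣≡x+k ⟩
    x + k        ≡⟨ +-comm x k ⟩
    k + x        ∎
  where open ≤-Reasoning

mainTheorem5 : (k : ℕ) → 1 ≤ k →
    (p : ℕ) (ns : Vec ℕ p) → NonDecreasing ns →
    (k≤δ : k ≤ δ (completeMultipartite ns)) →
    (M≠∅ : ∃ (M k ns)) →
    γ×t k (completeMultipartite ns) k≤δ ≤ k + minimum (M? k ns) M≠∅
mainTheorem5 k _ p ns _ k≤δ M≠∅ =
  let m∈M , _ = minimum-isMinimum (M? k ns) M≠∅ in γ×t≤k+x ns k≤δ m∈M
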